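{- Every RiFle assignment game (with arbitrary nonnegative real data $(\beta_{ij},\gamma_{ij})$ and an arbitrary assignment of each agent as rigid or flexible) has at least one stable outcome; i.e. the set of stable outcomes is nonempty.
   Context: A RiFle assignment game consists of two disjoint sets of agents $P=\{p_1,\dots,p_n\}$ and $Q=\{q_1,\dots,q_n\}$, a pair of nonnegative real numbers $(\beta_{ij},\gamma_{ij})$ for every pair $(p_i,q_j)\in P\times Q$ (write $\alpha_{ij}=\beta_{ij}+\gamma_{ij}$), and a designation of every agent as either rigid or flexible. Let $\mathcal R$ be the set of pairs $(p_i,q_j)$ in which at least one of $p_i,q_j$ is rigid, and $\mathcal F$ the set of pairs in which both are flexible. An outcome $(\bar u,\bar v;\mu)$ consists of a matching $\mu$ between $P$ and $Q$ (a set of disjoint pairs $(p_i,q_j)$; write $p_i\stackrel{\mu}{\longleftrightarrow} q_j$) and payoff vectors $\bar u=(u_1,\dots,u_n)$, $\bar v=(v_1,\dots,v_n)\in\mathbb R^n$. It is feasible if: (1) $u_i\ge 0$, $v_j\ge 0$ for all $i,j$; (2) if a rigid agent $p_i$ is matched to $q_j$ then $u_i=\beta_{ij}$, and if moreover $q_j$ is flexible then $v_j\ge\gamma_{ij}$; symmetrically, if a rigid agent $q_j$ is matched to $p_i$ then $v_j=\gamma_{ij}$, and if moreover $p_i$ is flexible then $u_i\ge\beta_{ij}$; (3) $\sum_i u_i+\sum_j v_j=\sum_{p_i\stackrel{\mu}{\longleftrightarrow} q_j}\alpha_{ij}$. It is stable if it is feasible and $u_i+v_j\ge\alpha_{ij}$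 for all $(p_i,q_j)\in\mathcal F$, and ($u_i\ge\beta_{ij}$ or $v_j\ge\gamma_{ij}$) for all $(p_i,q_j)\in\mathcal R$. -}

module Defs where

open import Algebra.Bundles using (RawMonoid)
import Algebra.Definitions.RawMonoid as RawMonoidSum
open import Data.Bool using (Bool; T; if_then_else_)
open import Data.Fin using (Fin)
open import Data.Nat as ℕ using (ℕ)
import Data.Nat.Properties as ℕ
open import Data.Product using (∃; _×_; _,_)
open import Data.Rational as ℚ using (ℚ; 0ℚ; ½)
import Data.Rational.Properties as ℚ
open import Data.Rational.Solver using (module +-*-Solver)
open import Data.Sum using (_⊎_)
open import Data.Vec.Functional using (Vector)
open import Level using (0ℓ)
open import Relation.Binary.PropositionalEquality

-- Real numbers in Cantor's construction: Cauchy sequences of rationals, with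
-- equality (difference tending to 0) given as a setoid relation.

IsCauchy : (ℕ → ℚ) → Set
IsCauchy x = ∀ ε → 0ℚ ℚ.< ε →
  ∃ λ N → ∀ m n → N ℕ.≤ m → N ℕ.≤ n → ℚ.∣ x m ℚ.- x n ∣ ℚ.< ε

record ℝ : Set where
  constructor mkℝ
  field
    seq    : ℕ → ℚ
    cauchy : IsCauchy seq

open ℝ public

infix 4 _≈_ _≤_ _≥_

_≈_ : ℝ → ℝ → Set
x ≈ y = ∀ ε → 0ℚ ℚ.< ε →
  ∃ λ N → ∀ n → N ℕ.≤ n → ℚ.∣ seq x n ℚ.- seq y n ∣ ℚ.< ε

-- The terms of x may exceed those of y by a null sequence, so that _≤_ respects
-- _≈_; a termwise comparison would not.
_≤_ : ℝ → ℝ → Set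
x ≤ y = ∀ ε → 0ℚ ℚ.< ε →
  ∃ λ N → ∀ n → N ℕ.≤ n → seq x n ℚ.< seq y n ℚ.+ ε

_≥_ : ℝ → ℝ → Set
x ≥ y = y ≤ x

0ℝ : ℝ
0ℝ = mkℝ (λ _ → 0ℚ) (λ _ 0<ε → 0 , λ _ _ _ _ → 0<ε)

private
  halve-pos : ∀ ε → 0ℚ ℚ.< ε → 0ℚ ℚ.< ½ ℚ.* ε
  halve-pos ε 0<ε =
    subst (ℚ._< ½ ℚ.* ε) (ℚ.*-zeroʳ ½) (ℚ.*-monoʳ-<-pos ½ 0<ε)

  half+half : ∀ ε → ½ ℚ.* ε ℚ.+ ½ ℚ.* ε ≡ ε
  half+half ε = trans (sym (ℚ.*-distribʳ-+ ε ½ ½)) (ℚ.*-identityˡ ε)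

  interchange : ∀ a b c d →
    (a ℚ.+ b) ℚ.- (c ℚ.+ d) ≡ (a ℚ.- c) ℚ.+ (b ℚ.- d)
  interchange = solve 4
    (λ a b c d → (a :+ b) :- (c :+ d) := (a :- c) :+ (b :- d)) refl
    where open +-*-Solver

infixl 6 _+_

_+_ : ℝ → ℝ → ℝ
seq (x + y) n = seq x n ℚ.+ seq y n
cauchy (x + y) ε 0<ε
  with M , p ← cauchy x (½ ℚ.* ε) (halve-pos ε 0<ε)
     | N , q ← cauchy y (½ ℚ.* ε) (halve-pos ε 0<ε)
  = M ℕ.⊔ N , λ m n M⊔N≤m M⊔N≤n → let open ℚ.≤-Reasoning in begin-strict
    ℚ.∣ (seq x m ℚ.+ seq y m) ℚ.- (seq x n ℚ.+ seq y n) ∣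
      ≡⟨ cong ℚ.∣_∣ (interchange (seq x m) (seq y m) (seq x n) (seq y n)) ⟩
    ℚ.∣ (seq x m ℚ.- seq x n) ℚ.+ (seq y m ℚ.- seq y n) ∣
      ≤⟨ ℚ.∣p+q∣≤∣p∣+∣q∣ (seq x m ℚ.- seq x n) (seq y m ℚ.- seq y n) ⟩
    ℚ.∣ seq x m ℚ.- seq x n ∣ ℚ.+ ℚ.∣ seq y m ℚ.- seq y n ∣
      <⟨ ℚ.+-mono-<
           (p m n (ℕ.m⊔n≤o⇒m≤o M N M⊔N≤m) (ℕ.m⊔n≤o⇒m≤o M N M⊔N≤n))
           (q m n (ℕ.m⊔n≤o⇒n≤o M N M⊔N≤m) (ℕ.m⊔n≤o⇒n≤o M N M⊔N≤n)) ⟩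
    ½ ℚ.* ε ℚ.+ ½ ℚ.* ε
      ≡⟨ half+half ε ⟩
    ε ∎

+-0-rawMonoid : RawMonoid 0ℓ 0ℓ
+-0-rawMonoid = record { Carrier = ℝ ; _≈_ = _≈_ ; _∙_ = _+_ ; ε = 0ℝ }

open RawMonoidSum +-0-rawMonoid public using (sum)

data Kind : Set where
  rigid flexible : Kind

record RiFleGame (n : ℕ) : Set where
  field
    β γ   : Fin n → Fin n → ℝ
    β≥0   : ∀ i j → β i j ≥ 0ℝ
    γ≥0   : ∀ i j → γ i j ≥ 0ℝ
    kindP : Fin n → Kind
    kindQ : Fin n → Kind

  α : Fin n → Fin n → ℝ
  α i j = β i j + γ i j

  InR InF : Fin n → Fin n → Set
  InR i j = kindP i ≡ rigid ⊎ kindQ j ≡ rigid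
  InF i j = kindP i ≡ flexible × kindQ j ≡ flexible

-- A matching is a (not necessarily perfect) set of disjoint pairs, given by
-- its characteristic function.
record Matching (n : ℕ) : Set where
  field
    matched   : Fin n → Fin n → Bool
    disjointP : ∀ i j j′ → T (matched i j) → T (matched i j′) → j ≡ j′
    disjointQ : ∀ i i′ j → T (matched i j) → T (matched i′ j) → i ≡ i′

record Outcome (n : ℕ) : Set where
  field
    u v : Vector ℝ n
    μ   : Matching n

  open Matching μ public

module _ {n : ℕ} (G : RiFleGame n) (o : Outcome n) where
  open RiFleGame G
  open Outcome o

  record IsFeasible : Set where
    field
      u≥0 : ∀ i → u i ≥ 0ℝ
      v≥0 : ∀ j → v j ≥ 0ℝ
      rigidP : ∀ i j → T (matched i j) → kindP i ≡ rigid →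
               u i ≈ β i j × (kindQ j ≡ flexible → v j ≥ γ i j)
      rigidQ : ∀ i j → T (matched i j) → kindQ j ≡ rigid →
               v j ≈ γ i j × (kindP i ≡ flexible → u i ≥ β i j)
      balance : sum u + sum v
                ≈ sum (λ i → sum (λ j → if matched i j then α i j else 0ℝ))

  record IsStable : Set where
    field
      feasible : IsFeasible
      stableF  : ∀ i j → InF i j → u i + v j ≥ α i j
      stableR  : ∀ i j → InR i j → u i ≥ β i j ⊎ v j ≥ γ i j

module Submission where

-- If the data are integers, let every unmatched agent of P in turn offer its favourite q
-- the next acceptable price: one unit more than the current price for a flexible pair, γ
-- for a rigid one. Prices only rise and are bounded, so this stops, at an outcome that
-- satisfies all stability conditions except that u + v may fall short of α by one unit for
-- flexible pairs. Real data are rounded to the grid of mesh 2⁻ᵐ, which gives nearly stable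
-- outcomes for all m with payoffs in a compact box. Along a suitable subsequence the
-- matching is constant, each disjunction for a rigid pair is always settled the same way,
-- and the payoffs converge; the limit is stable.

open import Defs
open import Axiom.ExcludedMiddle using (ExcludedMiddle)
open import Data.Bool using (Bool; true; false; T; if_then_else_)
open import Data.Fin using (Fin; zero; suc; toℕ; fromℕ<)
open import Data.Fin.Properties using (_≟_; any?; suc-injective; toℕ-fromℕ<)
import Data.Integer as ℤ
import Data.Integer.Properties as ℤ
open import Data.List using (allFin)
open import Data.List.Extrema.Nat using (argmax; f[xs]≤f[argmax])
open import Data.List.Membership.Propositional.Properties using (∈-allFin)
import Data.List.Relation.Unary.All as All
open import Data.Maybe using (Maybe; just; nothing; maybe′)
open import Data.Maybe.Properties using (≡-dec; just-injective)
open import Data.Nat as ℕ using (ℕ; zero; suc; z≤n; s≤s)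
import Data.Nat.Coprimality as Coprime
open import Data.Nat.Induction using (<-wellFounded)
import Data.Nat.Properties as ℕ
open import Data.Product using (∃; _×_; _,_; proj₁; proj₂)
open import Data.Rational as ℚ using (ℚ; mkℚ; 0ℚ; 1ℚ; ½)
import Data.Rational.Properties as ℚ
open import Data.Rational.Solver using (module +-*-Solver)
open import Data.Sum using (_⊎_; inj₁; inj₂; map; [_,_]′)
open import Data.Vec.Functional using (updateAt)
open import Data.Vec.Functional.Properties using (updateAt-updates; updateAt-minimal)
open import Function using (_∘_; const)
open import Induction.WellFounded using (Acc; acc)
open import Level using (0ℓ)
open import Relation.Binary.PropositionalEquality
open import Relation.Nullary using (¬_; yes; no; isYes; contradiction; _×-dec_)
open import Relation.Nullary.Decidable using (toWitness; fromWitness)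

open import Algebra.Properties.CommutativeMonoid.Sum ℕ.+-0-commutativeMonoid
  using (sum-cong-≗; sum-replicate-zero; ∑-distrib-+; ∑-comm)
  renaming (sum to ∑)
open import Algebra.Properties.CommutativeMonoid.Sum ℚ.+-0-commutativeMonoid
  using () renaming (sum to ∑ℚ; sum-cong-≗ to ∑ℚ-cong)
open import Algebra.Properties.Monoid.Mult ℚ.+-0-monoid
  using (×-homo-+) renaming (_×_ to _·_)

-- Integer games

∑-mono-≤ : ∀ {n} {f g : Fin n → ℕ} → (∀ i → f i ℕ.≤ g i) → ∑ f ℕ.≤ ∑ g
∑-mono-≤ {zero}  f≤g = z≤n
∑-mono-≤ {suc n} f≤g = ℕ.+-mono-≤ (f≤g zero) (∑-mono-≤ (f≤g ∘ suc))

∑-mono-< : ∀ {n} {f g : Fin n → ℕ} → (∀ i → f i ℕ.≤ g i) →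
           ∀ j → f j ℕ.< g j → ∑ f ℕ.< ∑ g
∑-mono-< f≤g zero    fj<gj = ℕ.+-mono-<-≤ fj<gj (∑-mono-≤ (f≤g ∘ suc))
∑-mono-< f≤g (suc j) fj<gj = ℕ.+-mono-≤-< (f≤g zero) (∑-mono-< (f≤g ∘ suc) j fj<gj)

-- Books a payoff at the pair that earns it: in a row or column of the matching only the matched
-- entry contributes. The alternative `x ≡ 0` covers unmatched agents.
∑-indicator : ∀ {n} (b : Fin n → Bool) x → (∀ j k → T (b j) → T (b k) → j ≡ k) →
              (∃ λ j → T (b j)) ⊎ x ≡ 0 → ∑ (λ j → if b j then x else 0) ≡ x
∑-indicator {zero}  b x unique (inj₂ refl) = refl
∑-indicator {suc n} b x unique some with b zero in b0
... | true  = trans (cong (x ℕ.+_) (trans (sum-cong-≗ off) (sum-replicate-zero n))) (ℕ.+-identityʳ x)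
  where
  off : ∀ j → (if b (suc j) then x else 0) ≡ 0
  off j with b (suc j) in bj
  ... | false = refl
  ... | true with () ← unique zero (suc j) (subst T (sym b0) _) (subst T (sym bj) _)
... | false = ∑-indicator (b ∘ suc) x
  (λ j k p q → suc-injective (unique (suc j) (suc k) p q)) (shift some)
  where
  shift : (∃ λ j → T (b j)) ⊎ x ≡ 0 → (∃ λ j → T (b (suc j))) ⊎ x ≡ 0
  shift (inj₁ (zero  , p)) with () ← subst T b0 p
  shift (inj₁ (suc j , p)) = inj₁ (j , p)
  shift (inj₂ x≡0)         = inj₂ x≡0

-- Deferred acceptance with rising prices: i can pay j the next price above p,
-- and is then left with bid i j p; a bid of 0 means that i is not interested.
module DeferredAcceptance {n : ℕ} (bid pay price : Fin n → Fin n → ℕ → ℕ)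
  (Fair : Fin n → Fin n → ℕ → Set) (K : ℕ)
  (bid-anti   : ∀ i j {p q} → p ℕ.≤ q → bid i j q ℕ.≤ bid i j p)
  (price-incr : ∀ i j p → 0 ℕ.< bid i j p → p ℕ.< price i j p)
  (price-≤    : ∀ i j p → 0 ℕ.< bid i j p → price i j p ℕ.≤ K)
  (price-fair : ∀ i j p → 0 ℕ.< bid i j p → Fair i j (price i j p))
  (bid-≤-pay  : ∀ i j p → 0 ℕ.< bid i j p → bid i j p ℕ.≤ pay i j (price i j p))
  where

  -- The payoffs of P are not stored, since i keeps `pay i j (v j)` from its partner j. By `held`
  -- every positive price is actually paid by someone, and by `content` no matched agent gains from
  -- a new offer.
  record State : Set where
    field
      partner   : Fin n → Maybe (Fin n)
      v         : Fin n → ℕ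
      injective : ∀ {i k j} → partner i ≡ just j → partner k ≡ just j → i ≡ k
      held      : ∀ j → (∃ λ i → partner i ≡ just j) ⊎ v j ≡ 0
      fair      : ∀ {i j} → partner i ≡ just j → Fair i j (v j)
      content   : ∀ {i j} → partner i ≡ just j → ∀ k → bid i k (v k) ℕ.≤ pay i j (v j)

  open State

  initial : State
  partner   initial _ = nothing
  v         initial _ = 0
  injective initial ()
  held      initial _ = inj₂ refl
  fair      initial ()
  content   initial ()

  slack : State → ℕ
  slack s = ∑ (λ j → K ℕ.∸ v s j)

  module Step (s : State) (i j : Fin n) (free : partner s i ≡ nothing)
    (keen : 0 ℕ.< bid i j (v s j))
    (best : ∀ k → bid i k (v s k) ℕ.≤ bid i j (v s j)) where

    p : ℕ
    p = price i j (v s j)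

    v′ : Fin n → ℕ
    v′ = updateAt (v s) j (const p)

    v′-j : v′ j ≡ p
    v′-j = updateAt-updates j (v s)

    v′-other : ∀ {l} → l ≢ j → v′ l ≡ v s l
    v′-other {l} = updateAt-minimal l j (v s)

    v≤v′ : ∀ l → v s l ℕ.≤ v′ l
    v≤v′ l with l ≟ j
    ... | yes refl = ℕ.<⇒≤ (subst (v s j ℕ.<_) (sym v′-j) (price-incr i j _ keen))
    ... | no l≢j   = ℕ.≤-reflexive (sym (v′-other l≢j))

    -- The previous holder of j, if any, becomes free, while j only changes hands. A member of Q
    -- that has once been held is thus never abandoned, which keeps `held` true.
    partner′ : Fin n → Maybe (Fin n)
    partner′ k with k ≟ i | ≡-dec _≟_ (partner s k) (just j)
    ... | yes _ | _     = just j
    ... | no _  | yes _ = nothing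
    ... | no _  | no _  = partner s k

    partner′-i : partner′ i ≡ just j
    partner′-i with i ≟ i
    ... | yes _  = refl
    ... | no i≢i = contradiction refl i≢i

    partner′-keep : ∀ {k l} → l ≢ j → partner s k ≡ just l → partner′ k ≡ just l
    partner′-keep {k} l≢j eq with k ≟ i | ≡-dec _≟_ (partner s k) (just j)
    ... | yes refl | _      with () ← trans (sym free) eq
    ... | no _     | yes e  = contradiction (just-injective (trans (sym eq) e)) l≢j
    ... | no _     | no _   = eq

    partner′-inv : ∀ k {l} → partner′ k ≡ just l →
                   (k ≡ i × l ≡ j) ⊎ (l ≢ j × partner s k ≡ just l)
    partner′-inv k eq with k ≟ i | ≡-dec _≟_ (partner s k) (just j)
    ... | yes k≡i | _    = inj₁ (k≡i , sym (just-injective eq))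
    ... | no _    | no e = inj₂ ((λ { refl → e eq }) , eq)

    next : State
    partner next = partner′
    v       next = v′
    injective next {h} {k} a b with partner′-inv h a | partner′-inv k b
    ... | inj₁ (refl , _)    | inj₁ (refl , _)    = refl
    ... | inj₁ (_ , l≡j)     | inj₂ (l≢j , _)     = contradiction l≡j l≢j
    ... | inj₂ (l≢j , _)     | inj₁ (_ , l≡j)     = contradiction l≡j l≢j
    ... | inj₂ (_ , a′)      | inj₂ (_ , b′)      = injective s a′ b′
    held next l with l ≟ j
    ... | yes refl = inj₁ (i , partner′-i)
    ... | no l≢j with held s l
    ...   | inj₁ (k , eq) = inj₁ (k , partner′-keep l≢j eq)
    ...   | inj₂ v≡0      = inj₂ (trans (v′-other l≢j) v≡0)
    fair next {h} a with partner′-inv h a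
    ... | inj₁ (refl , refl) = subst (Fair i j) (sym v′-j) (price-fair i j _ keen)
    ... | inj₂ (l≢j , a′)    = subst (Fair _ _) (sym (v′-other l≢j)) (fair s a′)
    content next {h} {l} a k with partner′-inv h a
    -- Price rises only lower bids, j was the best choice at the old prices, and i is left with at
    -- least what it bid.
    ... | inj₁ (refl , refl) = begin
      bid i k (v′ k)    ≤⟨ bid-anti i k (v≤v′ k) ⟩
      bid i k (v s k)   ≤⟨ best k ⟩
      bid i j (v s j)   ≤⟨ bid-≤-pay i j _ keen ⟩
      pay i j p         ≡⟨ cong (pay i j) v′-j ⟨
      pay i j (v′ j)    ∎
      where open ℕ.≤-Reasoning
    ... | inj₂ (l≢j , a′) = begin
      bid h k (v′ k)    ≤⟨ bid-anti h k (v≤v′ k) ⟩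
      bid h k (v s k)   ≤⟨ content s a′ k ⟩
      pay h l (v s l)   ≡⟨ cong (pay h l) (v′-other l≢j) ⟨
      pay h l (v′ l)    ∎
      where open ℕ.≤-Reasoning

    -- The price of j rises and still does not exceed K, so the truncated difference at j really
    -- drops.
    slack-decr : slack next ℕ.< slack s
    slack-decr = ∑-mono-< (λ l → ℕ.∸-monoʳ-≤ K (v≤v′ l)) j
      (ℕ.∸-monoʳ-< (subst (v s j ℕ.<_) (sym v′-j) (price-incr i j _ keen))
                   (subst (ℕ._≤ K) (sym v′-j) (price-≤ i j _ keen)))

  Final : State → Set
  Final s = ∀ i → partner s i ≡ nothing → ∀ j → bid i j (v s j) ≡ 0

  run : ∀ s → Acc ℕ._<_ (slack s) → ∃ Final
  run s (acc rec)
    with any? (λ i → ≡-dec _≟_ (partner s i) nothing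
                    ×-dec any? (λ j → 0 ℕ.<? bid i j (v s j)))
  ... | no none = s , λ i free j → ℕ.n≤0⇒n≡0 (ℕ.≮⇒≥ λ keen → none (i , free , j , keen))
  ... | yes (i , free , j₀ , keen) = run next (rec slack-decr)
    where
    offer : Fin n → ℕ
    offer j = bid i j (v s j)
    best : ∀ k → offer k ℕ.≤ offer (argmax offer j₀ (allFin n))
    best k = All.lookup (f[xs]≤f[argmax] {f = offer} j₀ (allFin n)) (∈-allFin k)
    -- The favourite attracts a bid at least as high as the one at `j₀`, hence a positive one.
    open Step s i (argmax offer j₀ (allFin n)) free (ℕ.<-≤-trans keen (best j₀)) best

  final : ∃ Final
  final = run initial (<-wellFounded _)

-- Nearly stable outcomes of integer games

term≤∑ : ∀ {n} (f : Fin n → ℕ) i → f i ℕ.≤ ∑ f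
term≤∑ f zero    = ℕ.m≤m+n (f zero) _
term≤∑ f (suc i) = ℕ.≤-trans (term≤∑ (f ∘ suc) i) (ℕ.m≤n+m _ (f zero))

-- E marks the pairs of two flexible agents.
record NearlyStable {n} (β γ : Fin n → Fin n → ℕ) (E : Fin n → Fin n → Bool) : Set where
  field
    u v : Fin n → ℕ
    μ   : Matching n
  open Matching μ public
  field
    matchedR : ∀ i j → E i j ≡ false → T (matched i j) → u i ≡ β i j × v j ≡ γ i j
    balance  : ∑ u ℕ.+ ∑ v
               ≡ ∑ (λ i → ∑ (λ j → if matched i j then β i j ℕ.+ γ i j else 0))
    nearF    : ∀ i j → E i j ≡ true → β i j ℕ.+ γ i j ℕ.≤ suc (u i ℕ.+ v j)
    stableR  : ∀ i j → E i j ≡ false → β i j ℕ.≤ u i ⊎ γ i j ℕ.≤ v j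
    u-bound  : ∀ i → u i ≡ 0 ⊎ ∃ λ j → u i ℕ.≤ β i j ℕ.+ γ i j
    v-bound  : ∀ j → v j ≡ 0 ⊎ ∃ λ i → v j ℕ.≤ β i j ℕ.+ γ i j

module _ {n} (β γ : Fin n → Fin n → ℕ) (E : Fin n → Fin n → Bool) where

  private
    -- In a flexible pair the bid is what remains of the surplus b + c after the next price p + 1.
    -- In a rigid pair the only possible price is c, which leaves b; once the price has reached c
    -- the bid drops to 0, matching the disjunction in the stability condition. A rigid pair with c
    -- = 0 is therefore never formed.
    bidᵉ payᵉ priceᵉ : Bool → ℕ → ℕ → ℕ → ℕ
    bidᵉ   true  b c p = (b ℕ.+ c) ℕ.∸ suc p
    bidᵉ   false b c p with p ℕ.<? c
    ... | yes _ = b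
    ... | no _  = 0
    payᵉ   true  b c p = (b ℕ.+ c) ℕ.∸ p
    payᵉ   false b c p = b
    priceᵉ true  b c p = suc p
    priceᵉ false b c p = c

    Fairᵉ : Bool → ℕ → ℕ → ℕ → Set
    Fairᵉ true  b c p = p ℕ.≤ b ℕ.+ c
    Fairᵉ false b c p = p ≡ c

    bid-antiᵉ : ∀ e b c {p q} → p ℕ.≤ q → bidᵉ e b c q ℕ.≤ bidᵉ e b c p
    bid-antiᵉ true  b c p≤q = ℕ.∸-monoʳ-≤ (b ℕ.+ c) (s≤s p≤q)
    bid-antiᵉ false b c {p} {q} p≤q with q ℕ.<? c | p ℕ.<? c
    ... | yes q<c | yes _  = ℕ.≤-refl
    ... | yes q<c | no p≮c = contradiction (ℕ.≤-<-trans p≤q q<c) p≮c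
    ... | no _    | _      = z≤n

    price-incrᵉ : ∀ e b c p → 0 ℕ.< bidᵉ e b c p → p ℕ.< priceᵉ e b c p
    price-incrᵉ true  b c p keen = ℕ.≤-refl
    price-incrᵉ false b c p keen with p ℕ.<? c
    ... | yes p<c = p<c
    ... | no _ with () ← keen

    price-fairᵉ : ∀ e b c p → 0 ℕ.< bidᵉ e b c p → Fairᵉ e b c (priceᵉ e b c p)
    price-fairᵉ true  b c p keen = ℕ.<⇒≤ (ℕ.m∸n≢0⇒n<m (ℕ.>⇒≢ keen))
    price-fairᵉ false b c p keen = refl

    Fair⇒≤ : ∀ e b c {p} → Fairᵉ e b c p → p ℕ.≤ b ℕ.+ c
    Fair⇒≤ true  b c fair = fair
    Fair⇒≤ false b c refl = ℕ.m≤n+m c b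

    bid-≤-payᵉ : ∀ e b c p → bidᵉ e b c p ℕ.≤ payᵉ e b c (priceᵉ e b c p)
    bid-≤-payᵉ true  b c p = ℕ.≤-refl
    bid-≤-payᵉ false b c p with p ℕ.<? c
    ... | yes _ = ℕ.≤-refl
    ... | no _  = z≤n

    pay-≤ : ∀ e b c p → payᵉ e b c p ℕ.≤ b ℕ.+ c
    pay-≤ true  b c p = ℕ.m∸n≤m _ p
    pay-≤ false b c p = ℕ.m≤m+n b c

    -- Fairness keeps the price of a flexible pair within the surplus, so the truncated subtraction
    -- is exact.
    pay+p : ∀ e b c p → Fairᵉ e b c p → payᵉ e b c p ℕ.+ p ≡ b ℕ.+ c
    pay+p true  b c p fair = ℕ.m∸n+n≡m fair
    pay+p false b c p refl = refl

    bid pay price : Fin n → Fin n → ℕ → ℕ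
    bid   i j = bidᵉ   (E i j) (β i j) (γ i j)
    pay   i j = payᵉ   (E i j) (β i j) (γ i j)
    price i j = priceᵉ (E i j) (β i j) (γ i j)

    total : ℕ
    total = ∑ λ i → ∑ λ j → β i j ℕ.+ γ i j

    open DeferredAcceptance bid pay price (λ i j → Fairᵉ (E i j) (β i j) (γ i j)) total
      (λ i j → bid-antiᵉ (E i j) (β i j) (γ i j))
      (λ i j → price-incrᵉ (E i j) (β i j) (γ i j))
      -- A fair price is at most its own entry β + γ, hence at most the sum of all entries, which
      -- serves as the price cap K.
      (λ i j p keen → ℕ.≤-trans (Fair⇒≤ (E i j) _ _ (price-fairᵉ (E i j) _ _ p keen))
        (ℕ.≤-trans (term≤∑ _ j) (term≤∑ (λ i → ∑ λ j → β i j ℕ.+ γ i j) i)))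
      (λ i j → price-fairᵉ (E i j) (β i j) (γ i j))
      (λ i j p _ → bid-≤-payᵉ (E i j) (β i j) (γ i j) p)

    open State (proj₁ final)

    payoff : Fin n → Maybe (Fin n) → ℕ
    payoff i = maybe′ (λ j → pay i j (v j)) 0

    u : Fin n → ℕ
    u i = payoff i (partner i)

    u-matched : ∀ {i j} → partner i ≡ just j → u i ≡ pay i j (v j)
    u-matched {i} = cong (payoff i)

    matched : Fin n → Fin n → Bool
    matched i j = isYes (≡-dec _≟_ (partner i) (just j))

    matched⇒ : ∀ i j → T (matched i j) → partner i ≡ just j
    matched⇒ i j = toWitness

    -- Matched agents are `content`, and for free agents the final state leaves only zero bids. Both
    -- stability conditions are read off from this inequality.
    bid≤u : ∀ i j → bid i j (v j) ℕ.≤ u i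
    bid≤u i j with partner i in eq
    ... | just k  = content eq j
    ... | nothing = ℕ.≤-reflexive (proj₂ final i eq j)

    u-some : ∀ i → (∃ λ j → T (matched i j)) ⊎ u i ≡ 0
    u-some i = go (partner i) refl
      where
      go : ∀ m → partner i ≡ m → (∃ λ j → T (matched i j)) ⊎ u i ≡ 0
      go (just j) eq = inj₁ (j , fromWitness eq)
      go nothing  eq = inj₂ (cong (payoff i) eq)

    v-some : ∀ j → (∃ λ i → T (matched i j)) ⊎ v j ≡ 0
    v-some j with held j
    ... | inj₁ (i , eq) = inj₁ (i , fromWitness eq)
    ... | inj₂ v≡0      = inj₂ v≡0

    unique-j : ∀ i j j′ → T (matched i j) → T (matched i j′) → j ≡ j′
    unique-j i j j′ p q = just-injective (trans (sym (matched⇒ i j p)) (matched⇒ i j′ q))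

    unique-i : ∀ i i′ j → T (matched i j) → T (matched i′ j) → i ≡ i′
    unique-i i i′ j p q = injective (matched⇒ i j p) (matched⇒ i′ j q)

    split : ∀ i j → (if matched i j then u i else 0) ℕ.+ (if matched i j then v j else 0)
                    ≡ (if matched i j then β i j ℕ.+ γ i j else 0)
    split i j with ≡-dec _≟_ (partner i) (just j)
    ... | no _   = refl
    ... | yes eq = trans (cong (ℕ._+ v j) (u-matched eq))
                         (pay+p (E i j) _ _ (v j) (fair eq))

  nearlyStable : NearlyStable β γ E
  nearlyStable = record
    { u = u ; v = v
    ; μ = record { matched = matched ; disjointP = unique-j ; disjointQ = unique-i }
    ; matchedR = matchedR
    ; balance = balance
    ; nearF = nearF
    ; stableR = stableR
    ; u-bound = u-bound
    ; v-bound = v-bound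
    }
    where
    matchedR : ∀ i j → E i j ≡ false → T (matched i j) → u i ≡ β i j × v j ≡ γ i j
    matchedR i j e t with eq ← matched⇒ i j t | f ← fair (matched⇒ i j t)
      rewrite u-matched eq | e = refl , f

    nearF : ∀ i j → E i j ≡ true → β i j ℕ.+ γ i j ℕ.≤ suc (u i ℕ.+ v j)
    -- The bid is computed at the next price `suc (v j)`, not at `v j`; this is the one unit lost in
    -- the conclusion.
    nearF i j e with b ← bid≤u i j rewrite e = begin
      β i j ℕ.+ γ i j                               ≤⟨ ℕ.m≤n+m∸n _ (suc (v j)) ⟩
      suc (v j) ℕ.+ (β i j ℕ.+ γ i j ℕ.∸ suc (v j)) ≤⟨ ℕ.+-monoʳ-≤ (suc (v j)) b ⟩
      suc (v j) ℕ.+ u i                             ≡⟨ cong suc (ℕ.+-comm (v j) (u i)) ⟩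
      suc (u i ℕ.+ v j)                             ∎
      where open ℕ.≤-Reasoning

    stableR : ∀ i j → E i j ≡ false → β i j ℕ.≤ u i ⊎ γ i j ℕ.≤ v j
    -- While the price is below γ the bid is β itself, so `bid≤u` gives the first alternative.
    stableR i j e with b ← bid≤u i j rewrite e with v j ℕ.<? γ i j
    ... | yes _  = inj₁ b
    ... | no v≮γ = inj₂ (ℕ.≮⇒≥ v≮γ)

    u-bound : ∀ i → u i ≡ 0 ⊎ ∃ λ j → u i ℕ.≤ β i j ℕ.+ γ i j
    u-bound i with u-some i
    ... | inj₂ u≡0     = inj₁ u≡0
    ... | inj₁ (j , t) = inj₂ (j , subst (ℕ._≤ β i j ℕ.+ γ i j)
      (sym (u-matched (matched⇒ i j t))) (pay-≤ (E i j) _ _ (v j)))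

    v-bound : ∀ j → v j ≡ 0 ⊎ ∃ λ i → v j ℕ.≤ β i j ℕ.+ γ i j
    v-bound j with held j
    ... | inj₂ v≡0      = inj₁ v≡0
    ... | inj₁ (i , eq) = inj₂ (i , Fair⇒≤ (E i j) _ _ (fair eq))

    balance : ∑ u ℕ.+ ∑ v
              ≡ ∑ (λ i → ∑ (λ j → if matched i j then β i j ℕ.+ γ i j else 0))
    balance = begin
      ∑ u ℕ.+ ∑ v
        -- Every payoff is spread over the matrix of pairs; after exchanging the order of summation
        -- for `V`, both matrices are added entry by entry with `split`.
        ≡⟨ cong₂ ℕ._+_ (sum-cong-≗ λ i → sym (∑-indicator (matched i) (u i) (unique-j i) (u-some i)))
                       (sum-cong-≗ λ j → sym (∑-indicator (λ i → matched i j) (v j)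
                                                (λ i i′ → unique-i i i′ j) (v-some j))) ⟩
      ∑ (λ i → ∑ (U i)) ℕ.+ ∑ (λ j → ∑ (λ i → V i j))
        ≡⟨ cong (∑ (λ i → ∑ (U i)) ℕ.+_) (sym (∑-comm V)) ⟩
      ∑ (λ i → ∑ (U i)) ℕ.+ ∑ (λ i → ∑ (V i))
        ≡⟨ sym (∑-distrib-+ (∑ ∘ U) (∑ ∘ V)) ⟩
      ∑ (λ i → ∑ (U i) ℕ.+ ∑ (V i))
        ≡⟨ sum-cong-≗ (λ i → trans (sym (∑-distrib-+ (U i) (V i))) (sum-cong-≗ (split i))) ⟩
      ∑ (λ i → ∑ (λ j → if matched i j then β i j ℕ.+ γ i j else 0)) ∎
      where
      open ≡-Reasoning
      U V : Fin n → Fin n → ℕ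
      U i j = if matched i j then u i else 0
      V i j = if matched i j then v j else 0

-- Rational sequences

private
  -- Given directly in lowest terms, so that numerator and denominator are available by computation.
  fromℕ : ℕ → ℚ
  fromℕ k = mkℚ (ℤ.+ k) 0 (Coprime.sym (Coprime.1-coprimeTo k))

  1+fromℕ : ∀ k → 1ℚ ℚ.+ fromℕ k ≡ fromℕ (suc k)
  1+fromℕ k = trans (cong (ℚ._/ 1) (cong (λ z → ℤ.1ℤ ℤ.+ z) (ℤ.*-identityʳ (ℤ.+ k))))
                    (ℚ.↥p/↧p≡p (fromℕ (suc k)))

  ·1≡fromℕ : ∀ k → k · 1ℚ ≡ fromℕ k
  ·1≡fromℕ zero    = refl
  ·1≡fromℕ (suc k) = trans (cong (1ℚ ℚ.+_) (·1≡fromℕ k)) (1+fromℕ k)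

  -- The denominator is at least 1, so x is at most the absolute value of its numerator.
  below-fromℕ : ∀ x → x ℚ.< fromℕ (suc ℤ.∣ ℚ.↥ x ∣)
  below-fromℕ x@(mkℚ a b-1 _) = ℚ.*<* (begin-strict
    a ℤ.* ℤ.1ℤ                             ≡⟨ ℤ.*-identityʳ a ⟩
    a                                      ≤⟨ i≤∣i∣ a ⟩
    ℤ.+ ℤ.∣ a ∣                            <⟨ ℤ.+<+ (ℕ.n<1+n _) ⟩
    ℤ.+ suc ℤ.∣ a ∣                        ≤⟨ ℤ.+≤+ (ℕ.m≤m*n (suc ℤ.∣ a ∣) (suc b-1)) ⟩
    ℤ.+ (suc ℤ.∣ a ∣ ℕ.* suc b-1)          ≡⟨ ℤ.pos-* (suc ℤ.∣ a ∣) (suc b-1) ⟩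
    ℤ.+ suc ℤ.∣ a ∣ ℤ.* ℤ.+ suc b-1        ∎)
    where
    open ℤ.≤-Reasoning
    i≤∣i∣ : ∀ i → i ℤ.≤ ℤ.+ ℤ.∣ i ∣
    i≤∣i∣ (ℤ.+ n)    = ℤ.≤-refl
    i≤∣i∣ ℤ.-[1+ n ] = ℤ.-≤+

·1-* : ∀ k x → (k · 1ℚ) ℚ.* x ≡ k · x
·1-* zero    x = ℚ.*-zeroˡ x
·1-* (suc k) x = trans (ℚ.*-distribʳ-+ x 1ℚ (k · 1ℚ))
                       (cong₂ ℚ._+_ (ℚ.*-identityˡ x) (·1-* k x))

archimedean : ∀ {ε} x → 0ℚ ℚ.< ε → ∃ λ k → x ℚ.< k · ε
archimedean {ε} x 0<ε = k , (begin-strict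
  x                        ≡⟨ ℚ.*-identityʳ x ⟨
  x ℚ.* 1ℚ                 ≡⟨ cong (x ℚ.*_) (ℚ.*-inverseˡ ε) ⟨
  x ℚ.* (ℚ.1/ ε ℚ.* ε)     ≡⟨ ℚ.*-assoc x _ ε ⟨
  (x ℚ.* ℚ.1/ ε) ℚ.* ε     <⟨ ℚ.*-monoˡ-<-pos ε (below-fromℕ (x ℚ.* ℚ.1/ ε)) ⟩
  fromℕ k ℚ.* ε            ≡⟨ cong (ℚ._* ε) (·1≡fromℕ k) ⟨
  (k · 1ℚ) ℚ.* ε           ≡⟨ ·1-* k ε ⟩
  k · ε                    ∎)
  where
  open ℚ.≤-Reasoning
  instance
    pos = ℚ.positive 0<ε
    nz = ℚ.pos⇒nonZero ε
  k = suc ℤ.∣ ℚ.↥ (x ℚ.* ℚ.1/ ε) ∣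

·-nonNeg : ∀ k {x} → 0ℚ ℚ.≤ x → 0ℚ ℚ.≤ k · x
·-nonNeg zero    0≤x = ℚ.≤-refl
·-nonNeg (suc k) 0≤x = ℚ.+-mono-≤ 0≤x (·-nonNeg k 0≤x)

·-mono-≤ : ∀ {k l x y} → k ℕ.≤ l → 0ℚ ℚ.≤ y → x ℚ.≤ y → k · x ℚ.≤ l · y
·-mono-≤ {l = l} z≤n 0≤y x≤y = ·-nonNeg l 0≤y
·-mono-≤ (s≤s k≤l)   0≤y x≤y = ℚ.+-mono-≤ x≤y (·-mono-≤ k≤l 0≤y x≤y)

≤suc· : ∀ k {x} → 0ℚ ℚ.≤ x → x ℚ.≤ suc k · x
≤suc· k {x} 0≤x = subst (ℚ._≤ suc k · x) (ℚ.+-identityʳ x) (ℚ.+-monoʳ-≤ x (·-nonNeg k 0≤x))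

·-∑ : ∀ {n} (f : Fin n → ℕ) x → ∑ f · x ≡ ∑ℚ (λ i → f i · x)
·-∑ {zero}  f x = refl
·-∑ {suc n} f x = trans (×-homo-+ x (f zero) _) (cong (f zero · x ℚ.+_) (·-∑ (f ∘ suc) x))

abstract
  -- A search downwards from the Archimedean bound, stopping at the first multiple of d that does
  -- not exceed q. Being abstract, it is never unfolded during type checking.
  floor : ∀ {q d} → 0ℚ ℚ.≤ q → 0ℚ ℚ.< d → ∃ λ b → b · d ℚ.≤ q × q ℚ.< b · d ℚ.+ d
  floor {q} {d} 0≤q 0<d = let k , q<kd = archimedean q 0<d in descend k q<kd
    where
    descend : ∀ k → q ℚ.< k · d → ∃ λ b → b · d ℚ.≤ q × q ℚ.< b · d ℚ.+ d
    descend zero    q<0 = contradiction (ℚ.≤-<-trans 0≤q q<0) (ℚ.<-irrefl refl)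
    descend (suc k) q<  with k · d ℚ.≤? q
    ... | yes kd≤q = k , kd≤q , subst (q ℚ.<_) (ℚ.+-comm d (k · d)) q<
    ... | no  kd≰q = descend k (ℚ.≰⇒> kd≰q)

half+half : ∀ x → ½ ℚ.* x ℚ.+ ½ ℚ.* x ≡ x
half+half x = trans (sym (ℚ.*-distribʳ-+ x ½ ½)) (ℚ.*-identityˡ x)

½-pos : ∀ {ε} → 0ℚ ℚ.< ε → 0ℚ ℚ.< ½ ℚ.* ε
½-pos {ε} 0<ε = subst (ℚ._< ½ ℚ.* ε) (ℚ.*-zeroʳ ½) (ℚ.*-monoʳ-<-pos ½ 0<ε)

-- The mesh 2⁻ᵐ

δ : ℕ → ℚ
δ zero    = 1ℚ
δ (suc m) = ½ ℚ.* δ m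

0<δ : ∀ m → 0ℚ ℚ.< δ m
0<δ zero    = ℚ.positive⁻¹ 1ℚ
0<δ (suc m) = ½-pos (0<δ m)

·-double : ∀ k x → k · (½ ℚ.* x) ℚ.+ k · (½ ℚ.* x) ≡ k · x
·-double zero    x = refl
·-double (suc k) x = begin
  (h ℚ.+ k · h) ℚ.+ (h ℚ.+ k · h)   ≡⟨ interchange h (k · h) ⟩
  (h ℚ.+ h) ℚ.+ (k · h ℚ.+ k · h)   ≡⟨ cong₂ ℚ._+_ (half+half x) (·-double k x) ⟩
  x ℚ.+ k · x                       ∎
  where
  open ≡-Reasoning
  h = ½ ℚ.* x
  interchange : ∀ a b → (a ℚ.+ b) ℚ.+ (a ℚ.+ b) ≡ (a ℚ.+ a) ℚ.+ (b ℚ.+ b)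
  interchange = solve 2 (λ a b → (a :+ b) :+ (a :+ b) := (a :+ a) :+ (b :+ b)) refl
    where open +-*-Solver

-- A linear bound suffices to derive convergence to 0 from `archimedean`. In the induction the one
-- extra copy of `δ (suc m)` is bounded by `suc m` copies, and doubling these gives `suc m · δ m`.
suc·δ≤1 : ∀ m → suc m · δ m ℚ.≤ 1ℚ
suc·δ≤1 zero    = ℚ.≤-reflexive refl
suc·δ≤1 (suc m) = begin
  δ (suc m) ℚ.+ suc m · δ (suc m)
    ≤⟨ ℚ.+-monoˡ-≤ (suc m · δ (suc m)) (≤suc· m (ℚ.<⇒≤ (0<δ (suc m)))) ⟩
  suc m · δ (suc m) ℚ.+ suc m · δ (suc m)   ≡⟨ ·-double (suc m) (δ m) ⟩
  suc m · δ m                               ≤⟨ suc·δ≤1 m ⟩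
  1ℚ                                        ∎
  where open ℚ.≤-Reasoning

δ→0 : ∀ ε → 0ℚ ℚ.< ε → ∃ λ N → ∀ m → N ℕ.≤ m → δ m ℚ.< ε
-- If ε were at most `δ m` for some m ≥ N, then 1 < N · ε ≤ (m + 1) · `δ m` ≤ 1.
δ→0 ε 0<ε = let N , 1<Nε = archimedean 1ℚ 0<ε in N , λ m N≤m → ℚ.≰⇒> λ ε≤δ →
  ℚ.<-irrefl refl (ℚ.<-≤-trans 1<Nε (ℚ.≤-trans
    (·-mono-≤ (ℕ.m≤n⇒m≤1+n N≤m) (ℚ.<⇒≤ (0<δ m)) ε≤δ) (suc·δ≤1 m)))

∣-∣-swap : ∀ a b → ℚ.∣ a ℚ.- b ∣ ≡ ℚ.∣ b ℚ.- a ∣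
∣-∣-swap a b = trans (sym (ℚ.∣-p∣≡∣p∣ (a ℚ.- b))) (cong ℚ.∣_∣ (flip a b))
  where
  flip : ∀ a b → ℚ.- (a ℚ.- b) ≡ b ℚ.- a
  flip = solve 2 (λ a b → :- (a :- b) := b :- a) refl where open +-*-Solver

∣-∣<⇒<+ : ∀ {a b ε} → ℚ.∣ a ℚ.- b ∣ ℚ.< ε → a ℚ.< b ℚ.+ ε
∣-∣<⇒<+ {a} {b} {ε} h = begin-strict
  a                       ≡⟨ cancel a b ⟨
  b ℚ.+ (a ℚ.- b)         ≤⟨ ℚ.+-monoʳ-≤ b (p≤∣p∣ (a ℚ.- b)) ⟩
  b ℚ.+ ℚ.∣ a ℚ.- b ∣     <⟨ ℚ.+-monoʳ-< b h ⟩
  b ℚ.+ ε                 ∎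
  where
  open ℚ.≤-Reasoning
  cancel : ∀ a b → b ℚ.+ (a ℚ.- b) ≡ a
  cancel = solve 2 (λ a b → b :+ (a :- b) := a) refl where open +-*-Solver
  p≤∣p∣ : ∀ p → p ℚ.≤ ℚ.∣ p ∣
  p≤∣p∣ p with ℚ.≤-total 0ℚ p
  ... | inj₁ 0≤p = ℚ.≤-reflexive (sym (ℚ.0≤p⇒∣p∣≡p 0≤p))
  ... | inj₂ p≤0 = ℚ.≤-trans p≤0 (ℚ.0≤∣p∣ p)

<+⇒∣-∣< : ∀ {a b ε} → a ℚ.< b ℚ.+ ε → b ℚ.< a ℚ.+ ε → ℚ.∣ a ℚ.- b ∣ ℚ.< ε
<+⇒∣-∣< {a} {b} {ε} a< b< =
  [ (λ eq → subst (ℚ._< ε) (sym eq) (shift b a<))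
  , (λ eq → subst (ℚ._< ε) (trans (flip a b) (sym eq)) (shift a b<)) ]′
  (ℚ.∣p∣≡p∨∣p∣≡-p (a ℚ.- b))
  where
  cancel : ∀ c ε → (c ℚ.+ ε) ℚ.- c ≡ ε
  cancel = solve 2 (λ c ε → (c :+ ε) :- c := ε) refl where open +-*-Solver
  shift : ∀ c {d} → d ℚ.< c ℚ.+ ε → d ℚ.- c ℚ.< ε
  shift c {d} d< = subst (d ℚ.- c ℚ.<_) (cancel c ε) (ℚ.+-monoˡ-< (ℚ.- c) d<)
  flip : ∀ a b → b ℚ.- a ≡ ℚ.- (a ℚ.- b)
  flip = solve 2 (λ a b → b :- a := :- (a :- b)) refl where open +-*-Solver

<+ : ∀ {x y ε} → 0ℚ ℚ.< ε → x ℚ.≤ y → x ℚ.< y ℚ.+ ε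
<+ {x} {y} {ε} 0<ε x≤y = subst (ℚ._< y ℚ.+ ε) (ℚ.+-identityʳ x) (ℚ.+-mono-≤-< x≤y 0<ε)

-- Comparison of sequences up to null sequences

infix 4 _≲_ _∼_

-- The order of Defs on bare sequences, as a record so that X and Y can be inferred.
record _≲_ (X Y : ℕ → ℚ) : Set where
  constructor mk≲
  field
    eventually : ∀ ε → 0ℚ ℚ.< ε → ∃ λ N → ∀ n → N ℕ.≤ n → X n ℚ.< Y n ℚ.+ ε

open _≲_ public

_∼_ : (ℕ → ℚ) → (ℕ → ℚ) → Set
X ∼ Y = X ≲ Y × Y ≲ X

≤⇒≲ : ∀ {X Y} → (∀ n → X n ℚ.≤ Y n) → X ≲ Y
≤⇒≲ X≤Y = mk≲ λ ε 0<ε → 0 , λ n _ → <+ 0<ε (X≤Y n)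

≡⇒∼ : ∀ {X Y} → (∀ n → X n ≡ Y n) → X ∼ Y
≡⇒∼ X≡Y = ≤⇒≲ (λ n → ℚ.≤-reflexive (X≡Y n)) , ≤⇒≲ (λ n → ℚ.≤-reflexive (sym (X≡Y n)))

-- The ε/2 argument shared by transitivity and addition; `R` is the relation wanted between ε and
-- the index.
eventually₂ : ∀ {X Y Z W} {R : ℚ → ℕ → Set} → X ≲ Y → Z ≲ W →
  (∀ {ε} n → X n ℚ.< Y n ℚ.+ ½ ℚ.* ε → Z n ℚ.< W n ℚ.+ ½ ℚ.* ε → R ε n) →
  ∀ ε → 0ℚ ℚ.< ε → ∃ λ N → ∀ n → N ℕ.≤ n → R ε n
eventually₂ X≲Y Z≲W f ε 0<ε =
  let M , p = eventually X≲Y (½ ℚ.* ε) (½-pos 0<ε)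
      N , q = eventually Z≲W (½ ℚ.* ε) (½-pos 0<ε)
  in M ℕ.⊔ N , λ n le → f n (p n (ℕ.m⊔n≤o⇒m≤o M N le)) (q n (ℕ.m⊔n≤o⇒n≤o M N le))

≲-trans : ∀ {X Y Z} → X ≲ Y → Y ≲ Z → X ≲ Z
≲-trans {X} {Y} {Z} X≲Y Y≲Z = mk≲ (eventually₂ X≲Y Y≲Z λ {ε} n p q → begin-strict
  X n                                    <⟨ p ⟩
  Y n ℚ.+ ½ ℚ.* ε                        <⟨ ℚ.+-monoˡ-< (½ ℚ.* ε) q ⟩
  (Z n ℚ.+ ½ ℚ.* ε) ℚ.+ ½ ℚ.* ε          ≡⟨ ℚ.+-assoc (Z n) _ _ ⟩
  Z n ℚ.+ (½ ℚ.* ε ℚ.+ ½ ℚ.* ε)          ≡⟨ cong (Z n ℚ.+_) (half+half ε) ⟩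
  Z n ℚ.+ ε                              ∎)
  where open ℚ.≤-Reasoning

≲-+ : ∀ {X Y Z W} → X ≲ Y → Z ≲ W → (λ n → X n ℚ.+ Z n) ≲ (λ n → Y n ℚ.+ W n)
≲-+ {X} {Y} {Z} {W} X≲Y Z≲W = mk≲ (eventually₂ X≲Y Z≲W λ {ε} n p q → begin-strict
  X n ℚ.+ Z n                                        <⟨ ℚ.+-mono-< p q ⟩
  (Y n ℚ.+ ½ ℚ.* ε) ℚ.+ (W n ℚ.+ ½ ℚ.* ε)            ≡⟨ interchange (Y n) (W n) (½ ℚ.* ε) ⟩
  (Y n ℚ.+ W n) ℚ.+ (½ ℚ.* ε ℚ.+ ½ ℚ.* ε)            ≡⟨ cong (Y n ℚ.+ W n ℚ.+_) (half+half ε) ⟩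
  (Y n ℚ.+ W n) ℚ.+ ε                                ∎)
  where
  open ℚ.≤-Reasoning
  interchange : ∀ a b h → (a ℚ.+ h) ℚ.+ (b ℚ.+ h) ≡ (a ℚ.+ b) ℚ.+ (h ℚ.+ h)
  interchange = solve 3 (λ a b h → (a :+ h) :+ (b :+ h) := (a :+ b) :+ (h :+ h)) refl
    where open +-*-Solver

∼-trans : ∀ {X Y Z} → X ∼ Y → Y ∼ Z → X ∼ Z
∼-trans (X≲Y , Y≲X) (Y≲Z , Z≲Y) = ≲-trans X≲Y Y≲Z , ≲-trans Z≲Y Y≲X

∼-+ : ∀ {X Y Z W} → X ∼ Y → Z ∼ W → (λ n → X n ℚ.+ Z n) ∼ (λ n → Y n ℚ.+ W n)
∼-+ (X≲Y , Y≲X) (Z≲W , W≲Z) = ≲-+ X≲Y Z≲W , ≲-+ Y≲X W≲Z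

∼-∑ : ∀ {n} {X Y : Fin n → ℕ → ℚ} → (∀ i → X i ∼ Y i) →
      (λ k → ∑ℚ λ i → X i k) ∼ (λ k → ∑ℚ λ i → Y i k)
∼-∑ {zero}  X∼Y = ≡⇒∼ λ _ → refl
∼-∑ {suc n} X∼Y = ∼-+ (X∼Y zero) (∼-∑ (X∼Y ∘ suc))

∼⇒≈ : ∀ {X Y} → X ∼ Y →
      ∀ ε → 0ℚ ℚ.< ε → ∃ λ N → ∀ n → N ℕ.≤ n → ℚ.∣ X n ℚ.- Y n ∣ ℚ.< ε
∼⇒≈ (x≲y , y≲x) ε 0<ε =
  let M , p = eventually x≲y ε 0<ε
      N , q = eventually y≲x ε 0<ε
  in M ℕ.⊔ N , λ n le → <+⇒∣-∣< (p n (ℕ.m⊔n≤o⇒m≤o M N le)) (q n (ℕ.m⊔n≤o⇒n≤o M N le))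

≲-+δ : ∀ {X} {φ : ℕ → ℕ} → (∀ n → n ℕ.≤ φ n) → (λ n → X n ℚ.+ δ (φ n)) ≲ X
≲-+δ {X} {φ} n≤φ = mk≲ λ ε 0<ε → let N , p = δ→0 ε 0<ε in
  N , λ n N≤n → ℚ.+-monoʳ-< (X n) (p (φ n) (ℕ.≤-trans N≤n (n≤φ n)))

-- Both n and φ n lie beyond the Cauchy index. The limit payoffs are indexed along a subsequence and
-- the data β, γ are not; this reconciles the two.
cauchy-∘ : ∀ {X} → IsCauchy X → ∀ {φ} → (∀ n → n ℕ.≤ φ n) → X ∘ φ ∼ X
cauchy-∘ {X} c {φ} n≤φ =
  mk≲ (λ ε 0<ε → let N , p = c ε 0<ε in N , λ n N≤n →
    ∣-∣<⇒<+ (p (φ n) n (ℕ.≤-trans N≤n (n≤φ n)) N≤n)) ,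
  mk≲ (λ ε 0<ε → let N , p = c ε 0<ε in N , λ n N≤n →
    ∣-∣<⇒<+ (p n (φ n) N≤n (ℕ.≤-trans N≤n (n≤φ n))))

≲-∘ : ∀ {X Y φ} → (∀ n → n ℕ.≤ φ n) → X ≲ Y → X ∘ φ ≲ Y ∘ φ
≲-∘ {φ = φ} n≤φ X≲Y = mk≲ λ ε 0<ε → let N , p = eventually X≲Y ε 0<ε in
  N , λ n N≤n → p (φ n) (ℕ.≤-trans N≤n (n≤φ n))

∼-∘ : ∀ {X Y φ} → (∀ n → n ℕ.≤ φ n) → X ∼ Y → X ∘ φ ∼ Y ∘ φ
∼-∘ n≤φ (X≲Y , Y≲X) = ≲-∘ n≤φ X≲Y , ≲-∘ n≤φ Y≲X

-- A nonnegative real may have negative terms; these are rounded to 0.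
module Rounding (q : ℕ → ℚ) where

  private
    floor⁺ : ∀ m → ∃ λ b → b · δ m ℚ.≤ 0ℚ ℚ.⊔ q m × 0ℚ ℚ.⊔ q m ℚ.< b · δ m ℚ.+ δ m
    floor⁺ m = floor (ℚ.p≤p⊔q 0ℚ (q m)) (0<δ m)

  grid : ℕ → ℕ
  grid m = proj₁ (floor⁺ m)

  rounded : ℕ → ℚ
  rounded m = grid m · δ m

  rounded-≤ : ∀ m → rounded m ℚ.≤ 0ℚ ℚ.⊔ q m
  rounded-≤ m = proj₁ (proj₂ (floor⁺ m))

  -- Rounding down costs less than `δ m`, and replacing negative terms by 0 changes q by a null
  -- sequence because its limit is nonnegative.
  rounded-∼ : const 0ℚ ≲ q → rounded ∼ q
  rounded-∼ 0≲q = below , ≲-trans (≤⇒≲ λ n →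
      ℚ.≤-trans (ℚ.p≤q⊔p 0ℚ (q n)) (ℚ.<⇒≤ (proj₂ (proj₂ (floor⁺ n))))) (≲-+δ (λ _ → ℕ.≤-refl))
    where
    ⊔-< : ∀ {a b c} → a ℚ.< c → b ℚ.< c → a ℚ.⊔ b ℚ.< c
    ⊔-< {a} {b} a<c b<c with ℚ.⊔-sel a b
    ... | inj₁ eq = subst (ℚ._< _) (sym eq) a<c
    ... | inj₂ eq = subst (ℚ._< _) (sym eq) b<c
    below : rounded ≲ q
    below = mk≲ λ ε 0<ε → let N , p = eventually 0≲q ε 0<ε in N , λ n N≤n →
      ℚ.≤-<-trans (rounded-≤ n) (⊔-< (p n N≤n) (<+ 0<ε (ℚ.≤-refl {q n})))

-- Subsequences

Increasing : (ℕ → ℕ) → Set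
Increasing φ = ∀ {m n} → m ℕ.< n → φ m ℕ.< φ n

step⇒increasing : ∀ {φ} → (∀ k → φ k ℕ.< φ (suc k)) → Increasing φ
step⇒increasing {φ} step {m} {suc n} (s≤s m≤n) with ℕ.m≤n⇒m<n∨m≡n m≤n
... | inj₁ m<n  = ℕ.<-trans (step⇒increasing step m<n) (step n)
... | inj₂ refl = step n

increasing⇒≤ : ∀ {φ} → Increasing φ → ∀ k → k ℕ.≤ φ k
increasing⇒≤ inc zero    = z≤n
increasing⇒≤ inc (suc k) = ℕ.≤-<-trans (increasing⇒≤ inc k) (inc (ℕ.n<1+n k))

-- Iterates `next` from `start`. The relation R between consecutive indices is what later makes a
-- subsequence monotone.
chain : (P : ℕ → Set) (R : ℕ → ℕ → Set) → ∃ P →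
        (∀ m → P m → ∃ λ k → m ℕ.< k × P k × R m k) →
        ∃ λ φ → Increasing φ × (∀ k → P (φ k)) × (∀ k → R (φ k) (φ (suc k)))
chain P R start next = proj₁ ∘ s , step⇒increasing (proj₁ ∘ s-next) , proj₂ ∘ s ,
                       λ k → proj₂ (proj₂ (s-next k))
  where
  s : ℕ → ∃ P
  s zero    = start
  s (suc k) = let m , p = s k ; l , _ , q , _ = next m p in l , q
  s-next : ∀ k → proj₁ (s k) ℕ.< proj₁ (s (suc k)) × P (proj₁ (s (suc k)))
                 × R (proj₁ (s k)) (proj₁ (s (suc k)))
  s-next k = let m , p = s k in proj₂ (next m p)

step⇒monotone : ∀ {X : ℕ → ℚ} → (∀ k → X k ℚ.≤ X (suc k)) → ∀ {m n} → m ℕ.≤ n → X m ℚ.≤ X n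
step⇒monotone step {n = zero}  z≤n = ℚ.≤-refl
step⇒monotone step {n = suc n} m≤1+n with ℕ.m≤n⇒m<n∨m≡n m≤1+n
... | inj₁ (s≤s m≤n) = ℚ.≤-trans (step⇒monotone step m≤n) (step n)
... | inj₂ refl      = ℚ.≤-refl

cauchy-neg : ∀ X → IsCauchy (λ k → ℚ.- X k) → IsCauchy X
cauchy-neg X c ε 0<ε = let N , p = c ε 0<ε in
  N , λ m n N≤m N≤n → subst (ℚ._< ε) (eq (X m) (X n)) (p m n N≤m N≤n)
  where
  eq : ∀ a b → ℚ.∣ (ℚ.- a) ℚ.- (ℚ.- b) ∣ ≡ ℚ.∣ a ℚ.- b ∣
  eq a b = trans (cong ℚ.∣_∣ (lemma a b)) (∣-∣-swap b a)
    where
    lemma : ∀ a b → (ℚ.- a) ℚ.- (ℚ.- b) ≡ b ℚ.- a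
    lemma = solve 2 (λ a b → (:- a) :- (:- b) := b :- a) refl where open +-*-Solver

-- Conditions on subsequences ordered by refinement: density says that every subsequence can be
-- refined to meet the condition, heredity that further refinement preserves it. Finitely many
-- conditions with both properties can be met at once.
Dense Hereditary : ((ℕ → ℕ) → Set) → Set
Dense C      = ∀ φ → Increasing φ → ∃ λ ψ → Increasing ψ × C (φ ∘ ψ)
Hereditary C = ∀ φ ψ → Increasing ψ → C φ → C (φ ∘ ψ)

-- Refine for C, then for D; heredity carries C through the second refinement.
dense-× : ∀ C D → Hereditary C → Dense C → Dense D → Dense (λ φ → C φ × D φ)
dense-× C D here dense dense′ φ inc =
  let ψ , incψ , c = dense φ inc
      χ , incχ , d = dense′ (φ ∘ ψ) (inc ∘ incψ)
  in ψ ∘ χ , incψ ∘ incχ , here (φ ∘ ψ) χ incχ c , d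

dense-∀ : ∀ {n} (C : Fin n → (ℕ → ℕ) → Set) → (∀ i → Hereditary (C i)) →
          (∀ i → Dense (C i)) → Dense (λ φ → ∀ i → C i φ)
dense-∀ {zero}  C here dense φ inc = (λ k → k) , (λ m<n → m<n) , λ ()
dense-∀ {suc n} C here dense φ inc =
  let ψ , incψ , c , cs = dense-× (C zero) (λ φ → ∀ i → C (suc i) φ) (here zero) (dense zero)
                            (dense-∀ (C ∘ suc) (here ∘ suc) (dense ∘ suc)) φ inc
  in ψ , incψ , λ { zero → c ; (suc i) → cs i }

cauchy-hereditary : ∀ X → Hereditary (λ φ → IsCauchy (X ∘ φ))
cauchy-hereditary X φ ψ inc c ε 0<ε = let N , p = c ε 0<ε in N , λ m n N≤m N≤n →
  p (ψ m) (ψ n) (ℕ.≤-trans N≤m (increasing⇒≤ inc m)) (ℕ.≤-trans N≤n (increasing⇒≤ inc n))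

Settled : (A B : ℕ → Set) → (ℕ → ℕ) → Set
Settled A B φ = (∀ k → A (φ k)) ⊎ (∀ k → B (φ k))

settled-hereditary : ∀ A B → Hereditary (Settled A B)
settled-hereditary A B φ ψ inc (inj₁ a) = inj₁ (a ∘ ψ)
settled-hereditary A B φ ψ inc (inj₂ b) = inj₂ (b ∘ ψ)

AllSettled : ∀ {n} (A B : Fin n → Fin n → ℕ → Set) → (ℕ → ℕ) → Set
AllSettled A B φ = ∀ i j → Settled (A i j) (B i j) φ

allSettled-hereditary : ∀ {n} (A B : Fin n → Fin n → ℕ → Set) → Hereditary (AllSettled A B)
allSettled-hereditary A B φ ψ inc c i j = settled-hereditary (A i j) (B i j) φ ψ inc (c i j)

-- Bolzano-Weierstrass and the infinite pigeonhole principle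

module Classical (em : ExcludedMiddle 0ℓ) where

  frequently : (P : ℕ → Set) →
    (∃ λ φ → Increasing φ × ∀ k → P (φ k)) ⊎ (∃ λ N → ∀ m → N ℕ.≤ m → ¬ P m)
  frequently P with em {P = ∃ λ N → ∀ m → N ℕ.≤ m → ¬ P m}
  ... | yes p = inj₂ p
  -- Consecutive indices need no further relation, so an inhabited type takes the place of R.
  ... | no ¬p = inj₁ (let φ , inc , p , _ = chain P (λ _ _ → ℕ)
                            (let m , _ , p = later 0 in m , p)
                            (λ m _ → let k , m<k , q = later (suc m) in k , m<k , q , 0)
                      in φ , inc , p)
    where
    later : ∀ N → ∃ λ m → N ℕ.≤ m × P m
    later N with em {P = ∃ λ m → N ℕ.≤ m × P m}
    ... | yes q = q
    ... | no ¬q = contradiction (N , λ m N≤m pm → ¬q (m , N≤m , pm)) ¬p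

  -- Either A holds infinitely often along φ, or it fails from some N on and B holds on the tail
  -- starting there.
  settled-dense : ∀ A B → (∀ m → A m ⊎ B m) → Dense (Settled A B)
  settled-dense A B A⊎B φ inc with frequently (A ∘ φ)
  ... | inj₁ (ψ , incψ , a) = ψ , incψ , inj₁ a
  ... | inj₂ (N , ¬a) = (N ℕ.+_) , ℕ.+-monoʳ-< N , inj₂ λ k → b (N ℕ.+ k) (ℕ.m≤m+n N k)
    where
    b : ∀ m → N ℕ.≤ m → B (φ m)
    b m N≤m with A⊎B (φ m)
    ... | inj₁ a  = contradiction a (¬a m N≤m)
    ... | inj₂ b′ = b′

  allSettled-dense : ∀ {n} (A B : Fin n → Fin n → ℕ → Set) → (∀ i j m → A i j m ⊎ B i j m) →
                     Dense (AllSettled A B)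
  allSettled-dense A B A⊎B = dense-∀ (λ i φ → ∀ j → Settled (A i j) (B i j) φ)
    (λ i φ ψ inc c j → settled-hereditary (A i j) (B i j) φ ψ inc (c j))
    (λ i → dense-∀ (λ j → Settled (A i j) (B i j))
             (λ j → settled-hereditary (A i j) (B i j))
             (λ j → settled-dense (A i j) (B i j) (A⊎B i j)))

  -- If no tail stayed within ε of its first term, the sequence could jump by at least ε again and
  -- again, and would climb above B.
  monotone-cauchy : ∀ {X B} → (∀ {m n} → m ℕ.≤ n → X m ℚ.≤ X n) → (∀ m → X m ℚ.≤ B) → IsCauchy X
  monotone-cauchy {X} {B} mono bound ε 0<ε
    with em {P = ∃ λ N → ∀ m → N ℕ.≤ m → X m ℚ.< X N ℚ.+ ε}
  ... | yes (N , p) = N , λ m n N≤m N≤n → <+⇒∣-∣<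
    (ℚ.<-≤-trans (p m N≤m) (ℚ.+-monoˡ-≤ ε (mono N≤n)))
    (ℚ.<-≤-trans (p n N≤n) (ℚ.+-monoˡ-≤ ε (mono N≤m)))
  ... | no ¬p = let k , B<kε = archimedean (B ℚ.- X 0) 0<ε
                    m , kε≤X = climb k
                in contradiction (ℚ.<-≤-trans (above k B<kε) (ℚ.≤-trans kε≤X (bound m)))
                                 (ℚ.<-irrefl refl)
    where
    jump : ∀ N → ∃ λ m → X N ℚ.+ ε ℚ.≤ X m
    jump N with em {P = ∃ λ m → X N ℚ.+ ε ℚ.≤ X m}
    ... | yes q = q
    ... | no ¬q = contradiction (N , λ m _ → ℚ.≰⇒> λ le → ¬q (m , le)) ¬p
    climb : ∀ k → ∃ λ m → k · ε ℚ.+ X 0 ℚ.≤ X m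
    climb zero = 0 , ℚ.≤-reflexive (ℚ.+-identityˡ (X 0))
    climb (suc k) = let m , h = climb k ; l , h′ = jump m in l , (begin
      (ε ℚ.+ k · ε) ℚ.+ X 0    ≡⟨ ℚ.+-assoc ε (k · ε) (X 0) ⟩
      ε ℚ.+ (k · ε ℚ.+ X 0)    ≤⟨ ℚ.+-monoʳ-≤ ε h ⟩
      ε ℚ.+ X m                ≡⟨ ℚ.+-comm ε (X m) ⟩
      X m ℚ.+ ε                ≤⟨ h′ ⟩
      X l                      ∎)
      where open ℚ.≤-Reasoning
    above : ∀ k → B ℚ.- X 0 ℚ.< k · ε → B ℚ.< k · ε ℚ.+ X 0
    above k lt = subst (ℚ._< k · ε ℚ.+ X 0) (cancel B (X 0)) (ℚ.+-monoˡ-< (X 0) lt)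
      where
      cancel : ∀ a b → (a ℚ.- b) ℚ.+ b ≡ a
      cancel = solve 2 (λ a b → (a :- b) :+ b := a) refl where open +-*-Solver

  -- Either infinitely many terms are peaks, not exceeded later, and these decrease, or
  -- from some point on every term is exceeded later.
  dense-cauchy : ∀ X {B} → (∀ m → 0ℚ ℚ.≤ X m) → (∀ m → X m ℚ.≤ B) →
                 Dense (λ φ → IsCauchy (X ∘ φ))
  dense-cauchy X 0≤X X≤B φ inc with frequently (λ m → ∀ k → m ℕ.< k → X (φ k) ℚ.≤ X (φ m))
  ... | inj₁ (ψ , incψ , peak) = ψ , incψ , cauchy-neg (X ∘ φ ∘ ψ) (monotone-cauchy
    (step⇒monotone λ k → ℚ.neg-antimono-≤ (peak k (ψ (suc k)) (incψ (ℕ.n<1+n k))))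
    (λ m → ℚ.neg-antimono-≤ (0≤X (φ (ψ m)))))
  ... | inj₂ (N , ¬peak) =
    let ψ , incψ , _ , up = chain (N ℕ.≤_) (λ m k → X (φ m) ℚ.≤ X (φ k)) (N , ℕ.≤-refl) higher
    in ψ , incψ , monotone-cauchy (step⇒monotone up) (λ m → X≤B (φ (ψ m)))
    where
    higher : ∀ m → N ℕ.≤ m → ∃ λ k → m ℕ.< k × N ℕ.≤ k × X (φ m) ℚ.≤ X (φ k)
    higher m N≤m with em {P = ∃ λ k → m ℕ.< k × N ℕ.≤ k × X (φ m) ℚ.≤ X (φ k)}
    ... | yes q = q
    ... | no ¬q = contradiction (λ k m<k → ℚ.<⇒≤ (ℚ.≰⇒> λ le →
      ¬q (k , m<k , ℕ.≤-trans N≤m (ℕ.<⇒≤ m<k) , le))) (¬peak m N≤m)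

-- Passage to the limit

finite-bound : ∀ {n} (x : Fin n → ℚ) → ∃ λ B → 0ℚ ℚ.≤ B × ∀ i → x i ℚ.≤ B
finite-bound {zero}  x = 0ℚ , ℚ.≤-refl , λ ()
finite-bound {suc n} x with B , 0≤B , x≤B ← finite-bound (x ∘ suc) =
  x zero ℚ.⊔ B , ℚ.≤-trans 0≤B (ℚ.p≤q⊔p (x zero) B) , λ
    { zero    → ℚ.p≤p⊔q (x zero) B
    ; (suc i) → ℚ.≤-trans (x≤B i) (ℚ.p≤q⊔p (x zero) B) }

cauchy-bounded : ∀ X → IsCauchy X → ∃ λ B → ∀ m → X m ℚ.≤ B
cauchy-bounded X c
  with N , p ← c 1ℚ (ℚ.positive⁻¹ 1ℚ)
  with B , _ , q ← finite-bound {N} (X ∘ toℕ)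
  = B ℚ.⊔ (X N ℚ.+ 1ℚ) , bound
  where
  bound : ∀ m → X m ℚ.≤ B ℚ.⊔ (X N ℚ.+ 1ℚ)
  bound m with m ℕ.<? N
  ... | yes m<N = ℚ.≤-trans (subst (λ k → X k ℚ.≤ B) (toℕ-fromℕ< m<N) (q (fromℕ< m<N)))
                            (ℚ.p≤p⊔q B _)
  ... | no  m≮N = ℚ.≤-trans (ℚ.<⇒≤ (∣-∣<⇒<+ (p m N (ℕ.≮⇒≥ m≮N) ℕ.≤-refl)))
                            (ℚ.p≤q⊔p B _)

seq-sum : ∀ {n} (x : Fin n → ℝ) k → seq (sum x) k ≡ ∑ℚ (λ i → seq (x i) k)
seq-sum {zero}  x k = refl
seq-sum {suc n} x k = cong (seq (x zero) k ℚ.+_) (seq-sum (x ∘ suc) k)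

both-flexible : Kind → Kind → Bool
both-flexible flexible flexible = true
both-flexible flexible rigid    = false
both-flexible rigid    _        = false

both-flexible-rigidʳ : ∀ k → both-flexible k rigid ≡ false
both-flexible-rigidʳ rigid    = refl
both-flexible-rigidʳ flexible = refl

module Limit (em : ExcludedMiddle 0ℓ) {n : ℕ} (G : RiFleGame n) where
  open RiFleGame G
  open Classical em
  private
    module B i j = Rounding (seq (β i j))
    module C i j = Rounding (seq (γ i j))

    E : Fin n → Fin n → Bool
    E i j = both-flexible (kindP i) (kindQ j)

    abstract
      -- Abstract, so that the limit argument sees only the properties of a nearly stable outcome
      -- and the algorithm is not unfolded.
      stage : ∀ m → NearlyStable (λ i j → B.grid i j m) (λ i j → C.grid i j m) E
      stage m = nearlyStable _ _ E

    module S m = NearlyStable (stage m)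

  U V : Fin n → ℕ → ℚ
  U i m = S.u m i · δ m
  V j m = S.v m j · δ m

  β̂ γ̂ α̂ : Fin n → Fin n → ℕ → ℚ
  β̂ = B.rounded
  γ̂ = C.rounded
  α̂ i j m = β̂ i j m ℚ.+ γ̂ i j m

  -- One bound for all pairs and all stages, giving the box that contains all payoffs. It is
  -- nonnegative in order to cover agents with payoff 0.
  α̂-bound : ∃ λ M → 0ℚ ℚ.≤ M × ∀ i j m → α̂ i j m ℚ.≤ M
  α̂-bound =
    let M , 0≤M , le = finite-bound (λ i → proj₁ (rows i))
    in M , 0≤M , λ i j m → ℚ.≤-trans
         (ℚ.≤-trans (proj₂ (cell i j) m) (proj₂ (proj₂ (rows i)) j)) (le i)
    where
    rounded-bound : ∀ x → ∃ λ M → ∀ m → Rounding.rounded (seq x) m ℚ.≤ M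
    rounded-bound x = let M , le = cauchy-bounded (seq x) (cauchy x) in
      0ℚ ℚ.⊔ M , λ m → ℚ.≤-trans (Rounding.rounded-≤ (seq x) m) (ℚ.⊔-monoʳ-≤ 0ℚ {M} {seq x m} (le m))
    cell : ∀ i j → ∃ λ M → ∀ m → α̂ i j m ℚ.≤ M
    cell i j = let M , p = rounded-bound (β i j) ; N , q = rounded-bound (γ i j) in
      M ℚ.+ N , λ m → ℚ.+-mono-≤ (p m) (q m)
    rows : ∀ i → ∃ λ M → 0ℚ ℚ.≤ M × ∀ j → proj₁ (cell i j) ℚ.≤ M
    rows i = finite-bound (λ j → proj₁ (cell i j))

  ·δ-mono : ∀ {k l} m → k ℕ.≤ l → k · δ m ℚ.≤ l · δ m
  ·δ-mono m k≤l = ·-mono-≤ k≤l (ℚ.<⇒≤ (0<δ m)) ℚ.≤-refl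

  ·δ≥0 : ∀ k m → 0ℚ ℚ.≤ k · δ m
  ·δ≥0 k m = ·-nonNeg k (ℚ.<⇒≤ (0<δ m))

  ·δ≤α̂ : ∀ {k} i j m → k ℕ.≤ B.grid i j m ℕ.+ C.grid i j m → k · δ m ℚ.≤ α̂ i j m
  ·δ≤α̂ i j m k≤ = ℚ.≤-trans (·δ-mono m k≤) (ℚ.≤-reflexive (×-homo-+ (δ m) (B.grid i j m) _))

  U-bound : ∀ i m → U i m ℚ.≤ proj₁ α̂-bound
  U-bound i m with S.u-bound m i
  ... | inj₁ u≡0      = subst (λ k → k · δ m ℚ.≤ _) (sym u≡0) (proj₁ (proj₂ α̂-bound))
  ... | inj₂ (j , le) = ℚ.≤-trans (·δ≤α̂ i j m le) (proj₂ (proj₂ α̂-bound) i j m)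

  V-bound : ∀ j m → V j m ℚ.≤ proj₁ α̂-bound
  V-bound j m with S.v-bound m j
  ... | inj₁ v≡0      = subst (λ k → k · δ m ℚ.≤ _) (sym v≡0) (proj₁ (proj₂ α̂-bound))
  ... | inj₂ (i , le) = ℚ.≤-trans (·δ≤α̂ i j m le) (proj₂ (proj₂ α̂-bound) i j m)

  -- The premise in `ContentQ` makes it vacuous for flexible pairs, so that one of `ContentP` and
  -- `ContentQ` holds for every pair at every stage.
  Matched Unmatched ContentP ContentQ : Fin n → Fin n → ℕ → Set
  Matched   i j m = T (S.matched m i j)
  Unmatched i j m = ¬ T (S.matched m i j)
  ContentP  i j m = B.grid i j m ℕ.≤ S.u m i
  ContentQ  i j m = E i j ≡ false → C.grid i j m ℕ.≤ S.v m j

  Payoffs Pattern Reason : (ℕ → ℕ) → Set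
  Payoffs φ = (∀ i → IsCauchy (U i ∘ φ)) × (∀ j → IsCauchy (V j ∘ φ))
  Pattern   = AllSettled Matched Unmatched
  Reason    = AllSettled ContentP ContentQ

  dense-payoffs : Dense Payoffs
  dense-payoffs = dense-× (λ φ → ∀ i → IsCauchy (U i ∘ φ)) (λ φ → ∀ j → IsCauchy (V j ∘ φ))
    (λ φ ψ inc c i → cauchy-hereditary (U i) φ ψ inc (c i))
    (dense-∀ _ (λ i → cauchy-hereditary (U i))
               (λ i → dense-cauchy (U i) (λ m → ·δ≥0 (S.u m i) m) (U-bound i)))
    (dense-∀ _ (λ j → cauchy-hereditary (V j))
               (λ j → dense-cauchy (V j) (λ m → ·δ≥0 (S.v m j) m) (V-bound j)))

  dense-pattern : Dense Pattern
  dense-pattern = allSettled-dense Matched Unmatched λ i j m → decide (S.matched m i j)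
    where
    decide : ∀ b → T b ⊎ ¬ T b
    decide true  = inj₁ _
    decide false = inj₂ λ ()

  dense-reason : Dense Reason
  dense-reason = allSettled-dense ContentP ContentQ decide
    where
    decide : ∀ i j m → ContentP i j m ⊎ ContentQ i j m
    decide i j m with B.grid i j m ℕ.≤? S.u m i
    ... | yes b≤u = inj₁ b≤u
    ... | no b≰u  = inj₂ λ e → [ (λ b≤u → contradiction b≤u b≰u) , (λ c≤v → c≤v) ]′
                                 (S.stableR m i j e)

  convergent : ∃ λ φ → Increasing φ × Payoffs φ × Pattern φ × Reason φ
  convergent =
    let φ , inc , payoffs , pairing , reason =
          dense-× Payoffs (λ φ → Pattern φ × Reason φ)
            (λ φ ψ inc (p , q) → (λ i → cauchy-hereditary (U i) φ ψ inc (p i))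
                               , (λ j → cauchy-hereditary (V j) φ ψ inc (q j)))
            dense-payoffs
            (dense-× Pattern Reason (allSettled-hereditary Matched Unmatched)
                     dense-pattern dense-reason)
            (λ k → k) (λ m<n → m<n)
    in φ , inc , payoffs , pairing , reason

  -- Stability of the limit outcome

  module _ (φ : ℕ → ℕ) (inc : Increasing φ)
           (payoffs : Payoffs φ) (pairing : Pattern φ) (reason : Reason φ) where

    outcome : Outcome n
    outcome = record
      { u = λ i → mkℝ (U i ∘ φ) (proj₁ payoffs i)
      ; v = λ j → mkℝ (V j ∘ φ) (proj₂ payoffs j)
      -- The matching is the same at all stages along φ, so the first one represents it.
      ; μ = S.μ (φ 0)
      }

    open Outcome outcome

    β̂∘φ∼β : ∀ i j → β̂ i j ∘ φ ∼ seq (β i j)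
    β̂∘φ∼β i j = ∼-trans (∼-∘ (increasing⇒≤ inc) (B.rounded-∼ i j (mk≲ (β≥0 i j))))
                        (cauchy-∘ (cauchy (β i j)) (increasing⇒≤ inc))

    γ̂∘φ∼γ : ∀ i j → γ̂ i j ∘ φ ∼ seq (γ i j)
    γ̂∘φ∼γ i j = ∼-trans (∼-∘ (increasing⇒≤ inc) (C.rounded-∼ i j (mk≲ (γ≥0 i j))))
                        (cauchy-∘ (cauchy (γ i j)) (increasing⇒≤ inc))

    matched-const : ∀ i j k → S.matched (φ k) i j ≡ matched i j
    matched-const i j k = T-const (S.matched (φ k) i j) (matched i j)
      (map (λ p → p k , p 0) (λ p → p k , p 0) (pairing i j))
      where
      T-const : ∀ a b → T a × T b ⊎ ¬ T a × ¬ T b → a ≡ b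
      T-const true  true  _ = refl
      T-const false false _ = refl
      T-const true  false (inj₂ (¬a , _)) = contradiction _ ¬a
      T-const false true  (inj₂ (_ , ¬b)) = contradiction _ ¬b

    payoff-β : ∀ i j → E i j ≡ false → T (matched i j) → U i ∘ φ ∼ seq (β i j)
    payoff-β i j e t = ∼-trans (≡⇒∼ λ k → cong (_· δ (φ k))
      (proj₁ (S.matchedR (φ k) i j e (subst T (sym (matched-const i j k)) t)))) (β̂∘φ∼β i j)

    payoff-γ : ∀ i j → E i j ≡ false → T (matched i j) → V j ∘ φ ∼ seq (γ i j)
    payoff-γ i j e t = ∼-trans (≡⇒∼ λ k → cong (_· δ (φ k))
      (proj₂ (S.matchedR (φ k) i j e (subst T (sym (matched-const i j k)) t)))) (γ̂∘φ∼γ i j)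

    payment : Fin n → Fin n → ℝ
    payment i j = if matched i j then α i j else 0ℝ

    gridPayment : Fin n → Fin n → ℕ → ℕ
    gridPayment i j m = if S.matched m i j then B.grid i j m ℕ.+ C.grid i j m else 0

    payment-∼ : ∀ i j → (λ k → gridPayment i j (φ k) · δ (φ k)) ∼ seq (payment i j)
    -- The matching of stage `φ k` is first replaced by the fixed one, so that a single case split
    -- serves all k.
    payment-∼ i j = ∼-trans (≡⇒∼ λ k → cong (λ b →
        (if b then B.grid i j (φ k) ℕ.+ C.grid i j (φ k) else 0) · δ (φ k)) (matched-const i j k))
      (by-cases (matched i j))
      where
      by-cases : ∀ b → (λ k → (if b then B.grid i j (φ k) ℕ.+ C.grid i j (φ k) else 0) · δ (φ k))
                       ∼ seq (if b then α i j else 0ℝ)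
      by-cases true  = ∼-trans (≡⇒∼ λ k → ×-homo-+ (δ (φ k)) (B.grid i j (φ k)) _)
                               (∼-+ (β̂∘φ∼β i j) (γ̂∘φ∼γ i j))
      by-cases false = ≡⇒∼ λ _ → refl

    -- The balance is exact at every stage; only the grid payments have to be replaced by the real
    -- ones, and finite sums respect `∼`.
    balance : (sum u + sum v) ≈ sum (λ i → sum (λ j → payment i j))
    balance = ∼⇒≈ (∼-trans (≡⇒∼ left) (∼-trans (∼-∑ λ i → ∼-∑ λ j → payment-∼ i j) (≡⇒∼ right)))
      where
      left : ∀ k → seq (sum u + sum v) k ≡ ∑ℚ λ i → ∑ℚ λ j → gridPayment i j (φ k) · δ (φ k)
      left k = begin
        seq (sum u) k ℚ.+ seq (sum v) k
          ≡⟨ cong₂ ℚ._+_ (seq-sum u k) (seq-sum v k) ⟩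
        ∑ℚ (λ i → U i (φ k)) ℚ.+ ∑ℚ (λ j → V j (φ k))
          ≡⟨ cong₂ ℚ._+_ (·-∑ (S.u (φ k)) (δ (φ k))) (·-∑ (S.v (φ k)) (δ (φ k))) ⟨
        ∑ (S.u (φ k)) · δ (φ k) ℚ.+ ∑ (S.v (φ k)) · δ (φ k)
          ≡⟨ ×-homo-+ (δ (φ k)) (∑ (S.u (φ k))) _ ⟨
        (∑ (S.u (φ k)) ℕ.+ ∑ (S.v (φ k))) · δ (φ k)
          ≡⟨ cong (_· δ (φ k)) (S.balance (φ k)) ⟩
        ∑ (λ i → ∑ (λ j → gridPayment i j (φ k))) · δ (φ k)
          ≡⟨ ·-∑ (λ i → ∑ (λ j → gridPayment i j (φ k))) (δ (φ k)) ⟩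
        ∑ℚ (λ i → ∑ (λ j → gridPayment i j (φ k)) · δ (φ k))
          ≡⟨ ∑ℚ-cong (λ i → ·-∑ (λ j → gridPayment i j (φ k)) (δ (φ k))) ⟩
        ∑ℚ (λ i → ∑ℚ λ j → gridPayment i j (φ k) · δ (φ k)) ∎
        where open ≡-Reasoning
      right : ∀ k → (∑ℚ λ i → ∑ℚ λ j → seq (payment i j) k) ≡ seq (sum λ i → sum λ j → payment i j) k
      right k = sym (trans (seq-sum (λ i → sum (payment i)) k) (∑ℚ-cong λ i → seq-sum (payment i) k))

    -- The unit missing at stage `φ k` is worth `δ (φ k)`, which tends to 0.
    stableF : ∀ i j → E i j ≡ true → (u i + v j) ≥ α i j
    stableF i j e = eventually (≲-trans (proj₂ (∼-+ (β̂∘φ∼β i j) (γ̂∘φ∼γ i j)))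
      (≲-trans (≤⇒≲ near)
               (≲-+δ {λ k → U i (φ k) ℚ.+ V j (φ k)} (increasing⇒≤ inc))))
      where
      near : ∀ k → α̂ i j (φ k) ℚ.≤ (U i (φ k) ℚ.+ V j (φ k)) ℚ.+ δ (φ k)
      near k = begin
        α̂ i j (φ k)
          ≡⟨ ×-homo-+ (δ (φ k)) (B.grid i j (φ k)) _ ⟨
        (B.grid i j (φ k) ℕ.+ C.grid i j (φ k)) · δ (φ k)
          ≤⟨ ·δ-mono (φ k) (S.nearF (φ k) i j e) ⟩
        δ (φ k) ℚ.+ (S.u (φ k) i ℕ.+ S.v (φ k) j) · δ (φ k)
          ≡⟨ cong (δ (φ k) ℚ.+_) (×-homo-+ (δ (φ k)) (S.u (φ k) i) _) ⟩
        δ (φ k) ℚ.+ (U i (φ k) ℚ.+ V j (φ k))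
          ≡⟨ ℚ.+-comm (δ (φ k)) _ ⟩
        (U i (φ k) ℚ.+ V j (φ k)) ℚ.+ δ (φ k) ∎
        where open ℚ.≤-Reasoning

    -- Since `Reason` selects the same alternative at all stages along φ, a single weak inequality
    -- passes to the limit.
    stableR : ∀ i j → E i j ≡ false → u i ≥ β i j ⊎ v j ≥ γ i j
    stableR i j e with reason i j
    ... | inj₁ b≤u = inj₁ (eventually (≲-trans (proj₂ (β̂∘φ∼β i j))
      (≤⇒≲ λ k → ·δ-mono (φ k) (b≤u k))))
    ... | inj₂ c≤v = inj₂ (eventually (≲-trans (proj₂ (γ̂∘φ∼γ i j))
      (≤⇒≲ λ k → ·δ-mono (φ k) (c≤v k e))))

    E-rigidP : ∀ i j → kindP i ≡ rigid → E i j ≡ false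
    E-rigidP i j eq = cong (λ k → both-flexible k (kindQ j)) eq

    E-rigidQ : ∀ i j → kindQ j ≡ rigid → E i j ≡ false
    E-rigidQ i j eq = trans (cong (both-flexible (kindP i)) eq) (both-flexible-rigidʳ (kindP i))

    outcome-stable : IsStable G outcome
    outcome-stable = record
      { feasible = record
        { u≥0 = λ i → eventually (≤⇒≲ λ k → ·δ≥0 (S.u (φ k) i) (φ k))
        ; v≥0 = λ j → eventually (≤⇒≲ λ k → ·δ≥0 (S.v (φ k) j) (φ k))
        -- Matched pairs with a rigid member always divide as exactly β and γ, so the inequality for
        -- a flexible partner holds with equality.
        ; rigidP = λ i j t r → let e = E-rigidP i j r in
            ∼⇒≈ (payoff-β i j e t) , λ _ → eventually (proj₂ (payoff-γ i j e t))
        ; rigidQ = λ i j t r → let e = E-rigidQ i j r in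
            ∼⇒≈ (payoff-γ i j e t) , λ _ → eventually (proj₂ (payoff-β i j e t))
        ; balance = balance
        }
      ; stableF = λ i j (f , g) → stableF i j (cong₂ both-flexible f g)
      ; stableR = λ i j → λ { (inj₁ r) → stableR i j (E-rigidP i j r)
                            ; (inj₂ r) → stableR i j (E-rigidQ i j r) }
      }

theorem1 : ExcludedMiddle 0ℓ → (n : ℕ) (G : RiFleGame n) → ∃ λ (o : Outcome n) → IsStable G o
theorem1 em n G = let φ , inc , payoffs , pairing , reason = convergent in
  outcome φ inc payoffs pairing reason , outcome-stable φ inc payoffs pairing reason
  where open Limit em G
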